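{- There exist infinitely many triangular numbers $\delta$ with $\delta \equiv 3 \pmod{12}$ such that the equation $x - y = \delta$ has no solution with $x$ and $y$ both perfect numbers.
   Context: A positive integer $N$ is perfect if $\sigma(N) = 2N$, where $\sigma$ denotes the sum-of-divisors function. A triangular number is an integer of the form $b(b-1)/2$ with $b$ a positive integer. -}

module Defs where

open import Data.Nat using (ℕ; suc; _+_; _*_; _<_; NonZero)
open import Data.Nat.Divisibility using (_∣_; _∣?_)
open import Data.List using (List; filter; upTo; map)
open import Data.Nat.ListAction using (sum)
open import Data.Product using (∃; _×_)
open import Relation.Binary.PropositionalEquality using (_≡_)

σ : ℕ → ℕ
σ n = sum (filter (_∣? n) (map suc (upTo n)))

Perfect : ℕ → Set
Perfect N = NonZero N × σ N ≡ 2 * N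

-- δ is triangular: δ = b(b-1)/2 for a positive integer b (stated as 2δ = b(b-1), b = suc k)
Triangular : ℕ → Set
Triangular δ = ∃ λ k → 2 * δ ≡ suc k * k

{-# OPTIONS --safe #-}
module Submission where

-- Take δ = g(2g − 1) with 4g − 1 = 11ⁿ, n ≡ 1 (mod 24), so that δ ≡ 15 (mod 36).
-- As δ is odd, exactly one of x, y is even, hence of the form P(2P − 1) with P = 2ᵏ.
-- If y is even, then x ≡ 3 (mod 4), or y = 6 and 3 divides x exactly once; in both
-- cases 4 ∣ σ(x), which is impossible for an odd perfect number.
-- If x is even, then y = A B with A = P − g and B = 2A + 11ⁿ, and A ≡ B ≡ 5 (mod 8).
-- A common factor of A and B is a power of 11; removing it exhibits y as a product
-- of two coprime factors, neither of them ≡ 1 (mod 8).  Neither is a square, so σ is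
-- even on both and again 4 ∣ σ(y).

open import Defs
open import Data.Nat using (ℕ; _+_; _<_; _%_)
open import Data.Product using (Σ; ∃; _×_)
open import Relation.Binary.PropositionalEquality using (_≡_)
open import Relation.Nullary using (¬_)

open import Data.Fin using (Fin; toℕ; fromℕ<)
open import Data.Fin.Properties using (all?; toℕ-fromℕ<)
open import Data.List using (List; []; _∷_; _++_; map; filter; upTo; cartesianProduct)
open import Data.List.Membership.Propositional using (_∈_)
open import Data.List.Membership.Propositional.Properties using (∈-map⁺; ∈-map⁻; ∈-filter⁺; ∈-filter⁻; ∈-upTo⁺; ∈-∃++; ∈-cartesianProduct⁺; ∈-cartesianProduct⁻)
open import Data.List.Membership.Propositional.Properties.WithK using (unique∧set⇒bag)
open import Data.List.Relation.Binary.BagAndSetEquality using (∼bag⇒↭)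
open import Data.List.Relation.Binary.Permutation.Propositional.Properties using (shift; ∈-resp-↭)
open import Data.List.Relation.Unary.All as All using (All; []; _∷_)
open import Data.List.Relation.Unary.AllPairs using ([]; _∷_)
open import Data.List.Relation.Unary.Any using (here; there)
open import Data.List.Relation.Unary.Unique.Propositional using (Unique)
import Data.List.Relation.Unary.Unique.Propositional.Properties as Unique
open import Data.Nat using (zero; suc; _*_; _^_; _≤_; _/_; _≟_; _<?_; NonZero; ≢-nonZero; ≢-nonZero⁻¹; >-nonZero⁻¹; s≤s; s≤s⁻¹; z≤n; z<s)
open import Data.Nat.Coprimality as Coprime using (Coprime; coprime-divisor; 1-coprimeTo)
open import Data.Nat.Divisibility
open import Data.Nat.DivMod
open import Data.Nat.GCD using (gcd; gcd[m,n]∣m; gcd[m,n]∣n; gcd[m,n]≢0)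
open import Data.Nat.Induction using (<-rec)
open import Data.Nat.ListAction using (sum)
open import Data.Nat.ListAction.Properties using (sum-↭)
open import Data.Nat.Primality using (Prime; prime?; prime⇒irreducible)
open import Data.Nat.Properties hiding (_≟_; _<?_)
open import Data.Nat.Tactic.RingSolver using (solve-∀)
open import Data.Product using (_,_; proj₁; proj₂; uncurry)
open import Data.Sum using (_⊎_; inj₁; inj₂)
open import Function using (_∘_; mk⇔)
open import Relation.Binary.PropositionalEquality using (_≢_; refl; sym; trans; cong; cong₂; subst; subst₂; module ≡-Reasoning)
open import Relation.Nullary using (yes; no; contradiction; ¬?)
open import Relation.Nullary.Decidable using (from-yes; from-no; _→-dec_; _×-dec_; _⊎-dec_)
open import Relation.Unary using (Decidable)

-- Sums over lists without repetition

-- Duplicate-free lists with the same members are permutations of each other. Each reindexing of a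
-- divisor sum below goes through this.
unique∧set⇒sum≡ : ∀ {xs ys} → Unique xs → Unique ys →
  (∀ {x} → x ∈ xs → x ∈ ys) → (∀ {x} → x ∈ ys → x ∈ xs) → sum xs ≡ sum ys
unique∧set⇒sum≡ u v f g = sum-↭ (∼bag⇒↭ (unique∧set⇒bag u v (mk⇔ f g)))

-- Injectivity is asked only on members of `xs`: the maps used later, multiplication of pairs and
-- `d ↦ n / d`, are injective on divisors but not everywhere.
unique-map⁺ : ∀ {A B : Set} (f : A → B) {xs} →
  (∀ {x y} → x ∈ xs → y ∈ xs → f x ≡ f y → x ≡ y) → Unique xs → Unique (map f xs)
unique-map⁺ f inj [] = []
unique-map⁺ f {x ∷ xs} inj (px ∷ u) =
  All.tabulate (λ z∈ fx≡z → let y , y∈ , z≡ = ∈-map⁻ f z∈ in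
    All.lookup px y∈ (inj (here refl) (there y∈) (trans fx≡z z≡)))
  ∷ unique-map⁺ f (λ p q → inj (there p) (there q)) u

-- Bounds `σ` from below by any explicit list of distinct divisors.
sum-mono-⊆ : ∀ {xs ys} → Unique xs → (∀ {x} → x ∈ xs → x ∈ ys) → sum xs ≤ sum ys
sum-mono-⊆ [] sub = z≤n
sum-mono-⊆ {x ∷ xs} (px ∷ u) sub with as , bs , refl ← ∈-∃++ (sub (here refl)) =
  ≤-trans (+-monoʳ-≤ x (sum-mono-⊆ u sub′)) (≤-reflexive (sym (sum-↭ (shift x as bs))))
  where
  sub′ : ∀ {z} → z ∈ xs → z ∈ as ++ bs
  sub′ z∈ with ∈-resp-↭ (shift x as bs) (sub (there z∈))
  ... | here z≡x = contradiction (sym z≡x) (All.lookup px z∈)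
  ... | there z∈′ = z∈′

sum-filter-split : ∀ {P : ℕ → Set} (P? : Decidable P) xs →
  sum xs ≡ sum (filter P? xs) + sum (filter (¬? ∘ P?) xs)
sum-filter-split P? [] = refl
sum-filter-split P? (x ∷ xs) with P? x
... | yes _ = trans (cong (x +_) (sum-filter-split P? xs)) (sym (+-assoc x _ _))
... | no  _ = trans (cong (x +_) (sum-filter-split P? xs)) (swap-summands x (sum (filter P? xs)) (sum (filter (¬? ∘ P?) xs)))
  where
  swap-summands : ∀ a b c → a + (b + c) ≡ b + (a + c)
  swap-summands = solve-∀

sum-products : ∀ xs ys → sum (map (uncurry _*_) (cartesianProduct xs ys)) ≡ sum xs * sum ys
sum-products [] ys = refl
sum-products (x ∷ xs) ys = begin
  sum (map (uncurry _*_) (map (x ,_) ys ++ cartesianProduct xs ys))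
    ≡⟨ row ys ⟩
  x * sum ys + sum (map (uncurry _*_) (cartesianProduct xs ys))
    ≡⟨ cong (x * sum ys +_) (sum-products xs ys) ⟩
  x * sum ys + sum xs * sum ys
    ≡⟨ *-distribʳ-+ (sum ys) x (sum xs) ⟨
  (x + sum xs) * sum ys ∎
  where
  open ≡-Reasoning
  row : ∀ zs {ws} → sum (map (uncurry _*_) (map (x ,_) zs ++ ws)) ≡ x * sum zs + sum (map (uncurry _*_) ws)
  row [] {ws} = cong (_+ sum (map (uncurry _*_) ws)) (sym (*-zeroʳ x))
  row (z ∷ zs) {ws} = begin
    x * z + sum (map (uncurry _*_) (map (x ,_) zs ++ ws)) ≡⟨ cong (x * z +_) (row zs) ⟩
    x * z + (x * sum zs + W)                              ≡⟨ +-assoc (x * z) _ _ ⟨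
    x * z + x * sum zs + W                                ≡⟨ cong (_+ W) (*-distribˡ-+ x z (sum zs)) ⟨
    x * (z + sum zs) + W                                  ∎
    where W = sum (map (uncurry _*_) ws)

-- The divisor sum

-- Definitionally the list summed by `σ`, so `σ n` and `sum (divisors n)` are interchangeable.
divisors : ℕ → List ℕ
divisors n = filter (_∣? n) (map suc (upTo n))

divisors-unique : ∀ n → Unique (divisors n)
divisors-unique n = Unique.filter⁺ (_∣? n) (Unique.map⁺ suc-injective (Unique.upTo⁺ n))

∈-divisors⁻ : ∀ n {d} → d ∈ divisors n → d ∣ n
∈-divisors⁻ n d∈ = proj₂ (∈-filter⁻ (_∣? n) {xs = map suc (upTo n)} d∈)

∈-divisors⁺ : ∀ n {d} → .{{NonZero n}} → d ∣ n → d ∈ divisors n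
∈-divisors⁺ n {zero} 0∣n = contradiction (0∣⇒≡0 0∣n) (≢-nonZero⁻¹ n)
∈-divisors⁺ n {suc d} d∣n = ∈-filter⁺ (_∣? n) (∈-map⁺ suc (∈-upTo⁺ (∣⇒≤ d∣n))) d∣n

coprime-∣ : ∀ {a b c d} → Coprime a b → c ∣ a → d ∣ b → Coprime c d
coprime-∣ cop c∣a d∣b (e∣c , e∣d) = cop (∣-trans e∣c c∣a , ∣-trans e∣d d∣b)

coprime-* : ∀ {a b c} → Coprime a b → Coprime a c → Coprime a (b * c)
coprime-* cab cac (d∣a , d∣bc) =
  cac (d∣a , coprime-divisor (coprime-∣ cab d∣a ∣-refl) d∣bc)

coprime-^ : ∀ {a b} n → Coprime a b → Coprime a (b ^ n)
coprime-^ zero    c = Coprime.sym (1-coprimeTo _)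
coprime-^ (suc n) c = coprime-* c (coprime-^ n c)

-- Take `e = gcd d a`; the quotient `d / e` is coprime to `a / e` and divides `(a / e) * b`, hence
-- divides `b`.
divisor-of-product : ∀ {d a b} → .{{NonZero a}} → d ∣ a * b → ∃ λ e → ∃ λ f → e ∣ a × f ∣ b × d ≡ e * f
divisor-of-product {d} {a} {b} d∣ab = g , d / g , gcd[m,n]∣n d a , f∣b , sym (m*[n/m]≡n (gcd[m,n]∣m d a))
  where
  g = gcd d a
  instance
    g≢0 : NonZero g
    g≢0 = ≢-nonZero (gcd[m,n]≢0 d a (inj₂ (≢-nonZero⁻¹ a)))
  f∣b : d / g ∣ b
  f∣b = coprime-divisor (Coprime.coprime-/gcd d a)
    (*-cancelˡ-∣ g (subst₂ _∣_ (sym (m*[n/m]≡n (gcd[m,n]∣m d a)))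
      (trans (cong (_* b) (sym (m*[n/m]≡n (gcd[m,n]∣n d a)))) (*-assoc g (a / g) b)) d∣ab))

-- Multiplication maps pairs of divisors bijectively onto the divisors of `a * b`: onto by
-- `divisor-of-product`, one-to-one by coprimality. The sum then factors by `sum-products`.
σ-multiplicative : ∀ a b → .{{NonZero a}} → .{{NonZero b}} → Coprime a b → σ (a * b) ≡ σ a * σ b
σ-multiplicative a b cop = trans
  (unique∧set⇒sum≡ (divisors-unique (a * b))
    (unique-map⁺ (uncurry _*_) inj (Unique.cartesianProduct⁺ (divisors-unique a) (divisors-unique b))) to from)
  (sum-products (divisors a) (divisors b))
  where
  instance
    ab≢0 : NonZero (a * b)
    ab≢0 = m*n≢0 a b
  split : ∀ {p} → p ∈ cartesianProduct (divisors a) (divisors b) → proj₁ p ∣ a × proj₂ p ∣ b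
  split p∈ = let u , v = ∈-cartesianProduct⁻ (divisors a) (divisors b) p∈ in ∈-divisors⁻ a u , ∈-divisors⁻ b v
  inj : ∀ {p q} → p ∈ cartesianProduct (divisors a) (divisors b) → q ∈ cartesianProduct (divisors a) (divisors b) →
        uncurry _*_ p ≡ uncurry _*_ q → p ≡ q
  inj {d , e} {d′ , e′} p∈ q∈ eq =
    let d∣a , e∣b = split p∈ ; d′∣a , e′∣b = split q∈ in
    cong₂ _,_
      (∣-antisym
        (coprime-divisor (coprime-∣ cop d∣a e′∣b) (subst (d ∣_) (trans eq (*-comm d′ e′)) (m∣m*n e)))
        (coprime-divisor (coprime-∣ cop d′∣a e∣b) (subst (d′ ∣_) (trans (sym eq) (*-comm d e)) (m∣m*n e′))))
      (∣-antisym
        (coprime-divisor (coprime-∣ (Coprime.sym cop) e∣b d′∣a) (subst (e ∣_) eq (n∣m*n d)))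
        (coprime-divisor (coprime-∣ (Coprime.sym cop) e′∣b d∣a) (subst (e′ ∣_) (sym eq) (n∣m*n d′))))
  to : ∀ {x} → x ∈ divisors (a * b) → x ∈ map (uncurry _*_) (cartesianProduct (divisors a) (divisors b))
  to x∈ with e , f , e∣a , f∣b , refl ← divisor-of-product {a = a} {b = b} (∈-divisors⁻ (a * b) x∈) =
    ∈-map⁺ (uncurry _*_) (∈-cartesianProduct⁺ (∈-divisors⁺ a e∣a) (∈-divisors⁺ b f∣b))
  from : ∀ {x} → x ∈ map (uncurry _*_) (cartesianProduct (divisors a) (divisors b)) → x ∈ divisors (a * b)
  from x∈ with p , p∈ , refl ← ∈-map⁻ (uncurry _*_) x∈ =
    let u , v = split p∈ in ∈-divisors⁺ (a * b) (*-pres-∣ u v)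

-- The value at zero is a default that makes `n / d` a total function, fit for `map`.
cofactor : ℕ → ℕ → ℕ
cofactor n zero    = zero
cofactor n (suc d) = n / suc d

cofactor-* : ∀ {n d} → d ∣ n → cofactor n d * d ≡ n
cofactor-* {d = zero}  0∣n = sym (0∣⇒≡0 0∣n)
cofactor-* {d = suc d} d∣n = m/n*n≡m d∣n

-- The involution d ↦ n / d pairs each divisor below √n with one above it.
∣σ-by-pairing : ∀ {q} n → .{{NonZero n}} →
  (∀ d e → d * e ≡ n → d ≢ e × q ∣ d + e) → q ∣ σ n
∣σ-by-pairing {q} n pair = subst (q ∣_) (sym σ≡) (pairs lower (λ d∈ → proj₁ (∈-lower⁻ d∈)))
  where
  small? : Decidable (λ d → d * d < n)
  small? d = d * d <? n
  c = cofactor n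
  lower upper : List ℕ
  lower = filter small? (divisors n)
  upper = filter (¬? ∘ small?) (divisors n)

  c∣ : ∀ {d} → d ∣ n → c d ∣ n
  c∣ {d} d∣n = subst (c d ∣_) (cofactor-* d∣n) (m∣m*n d)

  nonZero : ∀ {d} → d ∣ n → NonZero d
  nonZero {zero}  0∣n = contradiction (0∣⇒≡0 0∣n) (≢-nonZero⁻¹ n)
  nonZero {suc d} _   = _

  c-involutive : ∀ {d} → d ∣ n → c (c d) ≡ d
  c-involutive {d} d∣n = *-cancelʳ-≡ (c (c d)) d (c d) {{nonZero (c∣ d∣n)}}
    (trans (cofactor-* (c∣ d∣n)) (trans (sym (cofactor-* d∣n)) (*-comm (c d) d)))

  ∈-lower⁻ : ∀ {d} → d ∈ lower → d ∣ n × d * d < n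
  ∈-lower⁻ d∈ = let u , v = ∈-filter⁻ small? {xs = divisors n} d∈ in ∈-divisors⁻ n u , v

  large : ∀ {d} → d ∣ n → d * d < n → ¬ (c d * c d < n)
  large {d} d∣n dd<n = ≤⇒≯ (subst (_≤ c d * c d) (cofactor-* d∣n) (*-monoʳ-≤ (c d) (<⇒≤ d<cd)))
    where
    d<cd : d < c d
    d<cd = *-cancelʳ-< d d (c d) (subst (d * d <_) (sym (cofactor-* d∣n)) dd<n)

  small : ∀ {d} → d ∣ n → ¬ (d * d < n) → c d * c d < n
  small {d} d∣n dd≮n = subst (c d * c d <_) (cofactor-* d∣n)
    (*-monoʳ-< (c d) {{nonZero (c∣ d∣n)}} cd<d)
    where
    -- Equality is excluded since `pair d d` would yield `d ≢ d`: the hypothesis forces `n` to be a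
    -- non-square.
    n<dd : n < d * d
    n<dd = ≤∧≢⇒< (≮⇒≥ dd≮n) (λ eq → proj₁ (pair d d (sym eq)) refl)
    cd<d : c d < d
    cd<d = *-cancelʳ-< d (c d) d (subst (_< d * d) (sym (cofactor-* d∣n)) n<dd)

  upper≡ : sum upper ≡ sum (map c lower)
  upper≡ = unique∧set⇒sum≡ (Unique.filter⁺ (¬? ∘ small?) (divisors-unique n))
    (unique-map⁺ c (λ x∈ y∈ eq → trans (sym (c-involutive (proj₁ (∈-lower⁻ x∈))))
      (trans (cong c eq) (c-involutive (proj₁ (∈-lower⁻ y∈)))))
      (Unique.filter⁺ small? (divisors-unique n)))
    to from
    where
    to : ∀ {x} → x ∈ upper → x ∈ map c lower
    to {x} x∈ = let u , v = ∈-filter⁻ (¬? ∘ small?) {xs = divisors n} x∈ ; x∣n = ∈-divisors⁻ n u in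
      subst (_∈ map c lower) (c-involutive x∣n)
        (∈-map⁺ c (∈-filter⁺ small? (∈-divisors⁺ n (c∣ x∣n)) (small x∣n v)))
    from : ∀ {x} → x ∈ map c lower → x ∈ upper
    from x∈ with d , d∈ , refl ← ∈-map⁻ c x∈ = let d∣n , dd<n = ∈-lower⁻ d∈ in
      ∈-filter⁺ (¬? ∘ small?) (∈-divisors⁺ n (c∣ d∣n)) (large d∣n dd<n)

  σ≡ : σ n ≡ sum lower + sum (map c lower)
  σ≡ = trans (sum-filter-split small? (divisors n)) (cong (sum lower +_) upper≡)

  interchange : ∀ a b x y → (a + b) + (x + y) ≡ (a + x) + (b + y)
  interchange = solve-∀

  pairs : ∀ xs → (∀ {d} → d ∈ xs → d ∣ n) → q ∣ sum xs + sum (map c xs)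
  pairs [] _ = q ∣0
  pairs (x ∷ xs) h = subst (q ∣_) (interchange x (c x) (sum xs) _)
    (∣m∣n⇒∣m+n (proj₂ (pair x (c x) (trans (*-comm x (c x)) (cofactor-* (h (here refl))))))
               (pairs xs (h ∘ there)))

-- Even perfect numbers

prime∤⇒coprime : ∀ {p a} → Prime p → ¬ (p ∣ a) → Coprime a p
prime∤⇒coprime pr p∤a (d∣a , d∣p) with prime⇒irreducible pr d∣p
... | inj₁ d≡1  = d≡1
... | inj₂ refl = contradiction d∣a p∤a

2-prime : Prime 2
2-prime = from-yes (prime? 2)

-- If the quotient is even, a factor 2 cancels. If it is odd, it is coprime to the power of 2 that
-- it divides, so it is 1.
∣2^1+n⇒ : ∀ n {d} → d ∣ 2 ^ suc n → d ≡ 2 ^ suc n ⊎ d ∣ 2 ^ n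
∣2^1+n⇒ n {d} (divides q eq) with 2 ∣? q
... | yes (divides-refl r) = inj₂ (divides r (*-cancelˡ-≡ (2 ^ n) (r * d) 2 (trans eq (rearrange r d))))
  where
  rearrange : ∀ r d → r * 2 * d ≡ 2 * (r * d)
  rearrange = solve-∀
... | no 2∤q = inj₁ (sym (trans eq (trans (cong (_* d) q≡1) (*-identityˡ d))))
  where
  q≡1 : q ≡ 1
  q≡1 = coprime-^ (suc n) (prime∤⇒coprime 2-prime 2∤q) (∣-refl , divides d (trans eq (*-comm q d)))

1+σ[2^n]≡2^1+n : ∀ n → suc (σ (2 ^ n)) ≡ 2 ^ suc n
1+σ[2^n]≡2^1+n zero    = refl
1+σ[2^n]≡2^1+n (suc n) = begin
  suc (σ (2 ^ suc n))         ≡⟨ cong suc (unique∧set⇒sum≡ (divisors-unique (2 ^ suc n))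
                                   (All.tabulate new ∷ divisors-unique (2 ^ n)) to from) ⟩
  suc (2 ^ suc n + σ (2 ^ n)) ≡⟨ +-suc (2 ^ suc n) (σ (2 ^ n)) ⟨
  2 ^ suc n + suc (σ (2 ^ n)) ≡⟨ cong (2 ^ suc n +_) (1+σ[2^n]≡2^1+n n) ⟩
  2 ^ suc n + 2 ^ suc n       ≡⟨ cong (2 ^ suc n +_) (+-identityʳ (2 ^ suc n)) ⟨
  2 ^ suc (suc n)             ∎
  where
  open ≡-Reasoning
  instance
    2^n≢0 : NonZero (2 ^ n)
    2^n≢0 = m^n≢0 2 n
    2^1+n≢0 : NonZero (2 ^ suc n)
    2^1+n≢0 = m^n≢0 2 (suc n)
  new : ∀ {d} → d ∈ divisors (2 ^ n) → 2 ^ suc n ≢ d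
  new d∈ refl = <⇒≱ (^-monoʳ-< 2 (s≤s (s≤s z≤n)) (n<1+n n)) (∣⇒≤ (∈-divisors⁻ (2 ^ n) d∈))
  to : ∀ {d} → d ∈ divisors (2 ^ suc n) → d ∈ 2 ^ suc n ∷ divisors (2 ^ n)
  to d∈ with ∣2^1+n⇒ n (∈-divisors⁻ (2 ^ suc n) d∈)
  ... | inj₁ d≡  = here d≡
  ... | inj₂ d∣  = there (∈-divisors⁺ (2 ^ n) d∣)
  from : ∀ {d} → d ∈ 2 ^ suc n ∷ divisors (2 ^ n) → d ∈ divisors (2 ^ suc n)
  from (here refl) = ∈-divisors⁺ (2 ^ suc n) ∣-refl
  from (there d∈)  = ∈-divisors⁺ (2 ^ suc n) (∣n⇒∣m*n 2 (∈-divisors⁻ (2 ^ n) d∈))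

split-power-of-2 : ∀ n → .{{NonZero n}} → ∃ λ k → ∃ λ m → n ≡ 2 ^ k * m × ¬ (2 ∣ m)
split-power-of-2 n = <-rec (λ n → .{{NonZero n}} → ∃ λ k → ∃ λ m → n ≡ 2 ^ k * m × ¬ (2 ∣ m)) step n
  where
  step : ∀ n → (∀ {m} → m < n → .{{NonZero m}} → ∃ λ k → ∃ λ r → m ≡ 2 ^ k * r × ¬ (2 ∣ r)) →
         .{{NonZero n}} → ∃ λ k → ∃ λ m → n ≡ 2 ^ k * m × ¬ (2 ∣ m)
  step n rec with 2 ∣? n
  ... | no 2∤n = 0 , n , sym (*-identityˡ n) , 2∤n
  ... | yes 2∣n =
    let k , m , eq , 2∤m = rec (quotient-< 2∣n) {{quotient≢0 2∣n}} in
    suc k , m , trans (m∣n⇒n≡m*quotient 2∣n) (trans (cong (2 *_) eq) (sym (*-assoc 2 (2 ^ k) m))) , 2∤m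

-- The core of Euler's theorem on even perfect numbers, applied with `Q = σ (2 ^ suc k)`. As `Q`
-- divides `m`, writing `m = s * Q` turns the equation into `σ m ≡ s + m`.
Qσ[m]≡[1+Q]m⇒m≡Q : ∀ Q m → .{{NonZero m}} → Q ≢ 1 → Q * σ m ≡ suc Q * m → m ≡ Q
Qσ[m]≡[1+Q]m⇒m≡Q Q m Q≢1 Qσm≡ = trans m≡sQ (trans (cong (_* Q) s≡1) (*-identityˡ Q))
  where
  Q∣m : Q ∣ m
  Q∣m = ∣m+n∣m⇒∣n (subst (Q ∣_) (trans Qσm≡ (+-comm m (Q * m))) (m∣m*n (σ m))) (m∣m*n m)
  s = quotient Q∣m
  m≡sQ : m ≡ s * Q
  m≡sQ = m∣n⇒n≡quotient*m Q∣m
  instance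
    Q≢0 : NonZero Q
    Q≢0 = ≢-nonZero λ Q≡0 → ≢-nonZero⁻¹ m (trans m≡sQ (trans (cong (s *_) Q≡0) (*-zeroʳ s)))
    s≢0 : NonZero s
    s≢0 = quotient≢0 Q∣m
  σm≡s+m : σ m ≡ s + m
  σm≡s+m = *-cancelˡ-≡ (σ m) (s + m) Q (begin
    Q * σ m       ≡⟨ Qσm≡ ⟩
    m + Q * m     ≡⟨ cong (_+ Q * m) (trans m≡sQ (*-comm s Q)) ⟩
    Q * s + Q * m ≡⟨ *-distribˡ-+ Q s m ⟨
    Q * (s + m)   ∎)
    where open ≡-Reasoning
  -- Otherwise 1, s and m are three distinct divisors of m, while σ(m) = s + m.
  s≡1 : s ≡ 1
  s≡1 with s ≟ 1
  ... | yes s≡1 = s≡1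
  ... | no  s≢1 = contradiction
    (subst (s + (m + 1) ≤_) σm≡s+m (sum-mono-⊆ {s ∷ m ∷ 1 ∷ []}
      ((s≢m ∷ s≢1 ∷ []) ∷ (m≢1 ∷ []) ∷ [] ∷ [])
      λ { (here refl) → ∈-divisors⁺ m (quotient-∣ Q∣m)
        ; (there (here refl)) → ∈-divisors⁺ m ∣-refl
        ; (there (there (here refl))) → ∈-divisors⁺ m (1∣ m) }))
    (<⇒≱ (+-monoʳ-< s (m<m+n m z<s)))
    where
    s≢m : s ≢ m
    s≢m s≡m = Q≢1 (*-cancelˡ-≡ Q 1 s (trans (sym m≡sQ) (trans (sym s≡m) (sym (*-identityʳ s)))))
    m≢1 : m ≢ 1
    m≢1 m≡1 = s≢1 (m*n≡1⇒m≡1 s Q (trans (sym m≡sQ) m≡1))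

even-perfect⇒euclid : ∀ {x} → Perfect x → 2 ∣ x →
  ∃ λ k → ∃ λ Q → x ≡ 2 ^ suc k * Q × suc Q ≡ 2 * 2 ^ suc k
even-perfect⇒euclid {x} (x≢0 , σx≡2x) 2∣x with split-power-of-2 x {{x≢0}}
... | zero  , m , eq , 2∤m = contradiction (subst (2 ∣_) (trans eq (*-identityˡ m)) 2∣x) 2∤m
... | suc k , m , eq , 2∤m = k , σ P , trans eq (cong (P *_) m≡σP) , 1+σP≡2P
  where
  P = 2 ^ suc k
  instance
    P≢0 : NonZero P
    P≢0 = m^n≢0 2 (suc k)
    m≢0 : NonZero m
    m≢0 = ≢-nonZero λ m≡0 → 2∤m (subst (2 ∣_) (sym m≡0) (2 ∣0))
  1+σP≡2P : suc (σ P) ≡ 2 * P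
  1+σP≡2P = 1+σ[2^n]≡2^1+n (suc k)
  -- Otherwise `2 * P` would be 2, but `P` is even.
  σP≢1 : σ P ≢ 1
  σP≢1 σP≡1 = contradiction
    (m*n≡1⇒m≡1 2 (2 ^ k) (sym (*-cancelˡ-≡ 1 P 2 (trans (sym (cong suc σP≡1)) 1+σP≡2P))))
    λ ()
  σP*σm≡ : σ P * σ m ≡ suc (σ P) * m
  σP*σm≡ = begin
    σ P * σ m     ≡⟨ σ-multiplicative P m (Coprime.sym (coprime-^ (suc k) (prime∤⇒coprime 2-prime 2∤m))) ⟨
    σ (P * m)     ≡⟨ cong σ eq ⟨
    σ x           ≡⟨ σx≡2x ⟩
    2 * x         ≡⟨ cong (2 *_) eq ⟩
    2 * (P * m)   ≡⟨ *-assoc 2 P m ⟨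
    2 * P * m     ≡⟨ cong (_* m) 1+σP≡2P ⟨
    suc (σ P) * m ∎
    where open ≡-Reasoning
  m≡σP : m ≡ σ P
  m≡σP = Qσ[m]≡[1+Q]m⇒m≡Q (σ P) m σP≢1 σP*σm≡

-- Congruence obstructions

-- Lets a finite check, decided by evaluation over `Fin k`, be applied to remainders `n % k`.
residues : ∀ {k} (P : ℕ → Set) → (∀ (i : Fin k) → P (toℕ i)) → ∀ {r} → r < k → P r
residues P h r<k = subst P (toℕ-fromℕ< r<k) (h (fromℕ< r<k))

-- Since `q ∣ k`, divisibility of `d + e` by `q` is visible modulo `k`, and distinct residues give
-- distinct `d` and `e`; so the pairing hypothesis becomes a finite table.
∣σ-by-residues : ∀ k {q} .{{_ : NonZero k}} (S : ℕ → Set) → q ∣ k →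
  (∀ (i j : Fin k) → S ((toℕ i * toℕ j) % k) → toℕ i ≢ toℕ j × q ∣ (toℕ i + toℕ j) % k) →
  ∀ n .{{_ : NonZero n}} → S (n % k) → q ∣ σ n
∣σ-by-residues k {q} S q∣k check n Sn = ∣σ-by-pairing n pair
  where
  checkℕ : ∀ {a b} → a < k → b < k → S ((a * b) % k) → a ≢ b × q ∣ (a + b) % k
  checkℕ a<k b<k =
    residues (λ a → S ((a * _) % k) → a ≢ _ × q ∣ (a + _) % k)
      (λ i → residues (λ b → S ((toℕ i * b) % k) → toℕ i ≢ b × q ∣ (toℕ i + b) % k) (check i) b<k) a<k
  pair : ∀ d e → d * e ≡ n → d ≢ e × q ∣ d + e
  pair d e refl =
    let d≢e , q∣ = checkℕ (m%n<n d k) (m%n<n e k) (subst S (%-distribˡ-* d e k) Sn) in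
    (λ d≡e → d≢e (cong (_% k) d≡e)) ,
    ∣n∣m%n⇒∣m q∣k (subst (q ∣_) (sym (%-distribˡ-+ d e k)) q∣)

5or7 : ℕ → Set
5or7 r = r ≡ 5 ⊎ r ≡ 7

5or7? : Decidable 5or7
5or7? r = (r ≟ 5) ⊎-dec (r ≟ 7)

-- Odd squares are 1 modulo 8, so complementary divisors are distinct; both are odd, so their sum is
-- even.
5or7-mod-8⇒2∣σ : ∀ n .{{_ : NonZero n}} → 5or7 (n % 8) → 2 ∣ σ n
5or7-mod-8⇒2∣σ = ∣σ-by-residues 8 5or7 (divides 4 refl)
  (from-yes (all? λ (i : Fin 8) → all? λ (j : Fin 8) → 5or7? ((toℕ i * toℕ j) % 8)
    →-dec (¬? (toℕ i ≟ toℕ j) ×-dec (2 ∣? (toℕ i + toℕ j) % 8))))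

-- Of two complementary divisors one is 1 and the other 3 modulo 4.
3-mod-4⇒4∣σ : ∀ n .{{_ : NonZero n}} → n % 4 ≡ 3 → 4 ∣ σ n
3-mod-4⇒4∣σ = ∣σ-by-residues 4 (_≡ 3) ∣-refl
  (from-yes (all? λ (i : Fin 4) → all? λ (j : Fin 4) → ((toℕ i * toℕ j) % 4 ≟ 3)
    →-dec (¬? (toℕ i ≟ toℕ j) ×-dec (4 ∣? (toℕ i + toℕ j) % 4))))

perfect∧4∣σ⇒2∣ : ∀ {n} → Perfect n → 4 ∣ σ n → 2 ∣ n
perfect∧4∣σ⇒2∣ (_ , σn≡2n) 4∣σn = *-cancelˡ-∣ 2 (subst (4 ∣_) σn≡2n 4∣σn)

-- Products A (2A + 11ⁿ) with both factors ≡ 5 (mod 8)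

11^-mod-8 : ∀ j → 11 ^ j % 8 ≡ 1 ⊎ 11 ^ j % 8 ≡ 3
11^-mod-8 zero = inj₁ refl
11^-mod-8 (suc j) with 11^-mod-8 j
... | inj₁ eq = inj₂ (trans (%-distribˡ-* 11 (11 ^ j) 8) (cong (λ r → 3 * r % 8) eq))
... | inj₂ eq = inj₁ (trans (%-distribˡ-* 11 (11 ^ j) 8) (cong (λ r → 3 * r % 8) eq))

-- A power of 11 acts modulo 8 as 1 or 3, and `3 * 5` leaves 7. As 3 is its own inverse modulo 8,
-- cancelling the power in `11^-cancel-5or7` meets the same two residues.
11^-*-5or7 : ∀ j {E} → E % 8 ≡ 5 → 5or7 ((11 ^ j * E) % 8)
11^-*-5or7 j {E} E≡5 with 11^-mod-8 j
... | inj₁ eq = inj₁ (trans (%-distribˡ-* (11 ^ j) E 8) (cong₂ (λ r s → r * s % 8) eq E≡5))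
... | inj₂ eq = inj₂ (trans (%-distribˡ-* (11 ^ j) E 8) (cong₂ (λ r s → r * s % 8) eq E≡5))

11^-cancel-5or7 : ∀ j {C} → (11 ^ j * C) % 8 ≡ 5 → 5or7 (C % 8)
11^-cancel-5or7 j {C} eq with 11^-mod-8 j
... | inj₁ u = residues (λ r → (1 * r) % 8 ≡ 5 → 5or7 r)
  (from-yes (all? λ (i : Fin 8) → ((1 * toℕ i) % 8 ≟ 5) →-dec 5or7? (toℕ i))) (m%n<n C 8)
  (trans (cong (λ t → (t * (C % 8)) % 8) (sym u)) (trans (sym (%-distribˡ-* (11 ^ j) C 8)) eq))
... | inj₂ u = residues (λ r → (3 * r) % 8 ≡ 5 → 5or7 r)
  (from-yes (all? λ (i : Fin 8) → ((3 * toℕ i) % 8 ≟ 5) →-dec 5or7? (toℕ i))) (m%n<n C 8)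
  (trans (cong (λ t → (t * (C % 8)) % 8) (sym u)) (trans (sym (%-distribˡ-* (11 ^ j) C 8)) eq))

-- Both powers of 11 are moved to the side of `D`: the product is `C * R` with
-- `R = 11 ^ j * (11 ^ j * D)` coprime to `C`. Each factor has even `σ`, which forces the product to
-- be even, yet it is 25 ≡ 1 modulo 8.
¬perfect-by-coprime-factors : ∀ j C D → Coprime C D → Coprime C 11 →
  (11 ^ j * C) % 8 ≡ 5 → (11 ^ j * D) % 8 ≡ 5 → ¬ Perfect ((11 ^ j * C) * (11 ^ j * D))
¬perfect-by-coprime-factors j C D cop cop11 A≡5 B≡5 perf@(y≢0 , _) =
  contradiction (∣1⇒≡1 (subst (2 ∣_) y%8≡1 (%-presˡ-∣ (perfect∧4∣σ⇒2∣ perf 4∣σ) (divides 4 refl)))) λ ()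
  where
  A = 11 ^ j * C
  B = 11 ^ j * D
  R = 11 ^ j * B
  y≡CR : A * B ≡ C * R
  y≡CR = trans (cong (_* B) (*-comm (11 ^ j) C)) (*-assoc C (11 ^ j) B)
  instance
    CR≢0 : NonZero (C * R)
    CR≢0 = subst NonZero y≡CR y≢0
    C≢0 : NonZero C
    C≢0 = m*n≢0⇒m≢0 C
    R≢0 : NonZero R
    R≢0 = m*n≢0⇒n≢0 C
  4∣σ : 4 ∣ σ (A * B)
  4∣σ = subst (4 ∣_)
    (sym (trans (cong σ y≡CR)
      (σ-multiplicative C R (coprime-* (coprime-^ j cop11) (coprime-* (coprime-^ j cop11) cop)))))
    (*-pres-∣ (5or7-mod-8⇒2∣σ C (11^-cancel-5or7 j {C} A≡5)) (5or7-mod-8⇒2∣σ R (11^-*-5or7 j {B} B≡5)))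
  y%8≡1 : (A * B) % 8 ≡ 1
  y%8≡1 = trans (%-distribˡ-* A B 8) (cong₂ (λ r s → r * s % 8) A≡5 B≡5)

-- Here `p ^ j` is the gcd of `A` and `B`. The cofactor free of `p` is called `C`; the disjunction
-- records which of the two numbers it comes from.
CommonPower : ℕ → ℕ → ℕ → Set
CommonPower p A B = ∃ λ j → ∃ λ C → ∃ λ D → Coprime C D × Coprime C p ×
  ((A ≡ p ^ j * C × B ≡ p ^ j * D) ⊎ (A ≡ p ^ j * D × B ≡ p ^ j * C))

coprime-2A+p^n : ∀ {p A} n → Coprime A p → Coprime A (2 * A + p ^ n)
coprime-2A+p^n {p} {A} n c (d∣A , d∣B) = coprime-^ n c (d∣A , ∣m+n∣m⇒∣n d∣B (∣n⇒∣m*n 2 d∣A))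

-- Induction on `n`: while `p` divides `A`, it divides both numbers and can be removed, turning `n`
-- into `n - 1` and keeping the shape `2 * A + p ^ n`.
common-power : ∀ {p} → Prime p → ∀ n A → CommonPower p A (2 * A + p ^ n)
common-power {p} pr n A with p ∣? A
common-power {p} pr n A | no p∤A =
  0 , A , 2 * A + p ^ n , coprime-2A+p^n n c , c ,
  inj₁ (sym (*-identityˡ A) , sym (*-identityˡ _))
  where
  c : Coprime A p
  c = prime∤⇒coprime pr p∤A
-- With exponent 0 the second number is `2 * A + 1`, coprime to `A` and hence to `p`, so it takes
-- the role of `C`.
common-power {p} pr zero A | yes p∣A =
  0 , 2 * A + 1 , A ,
  (λ (d∣B , d∣A) → ∣1⇒≡1 (∣m+n∣m⇒∣n d∣B (∣n⇒∣m*n 2 d∣A))) ,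
  (λ (d∣B , d∣p) → ∣1⇒≡1 (∣m+n∣m⇒∣n d∣B (∣n⇒∣m*n 2 (∣-trans d∣p p∣A)))) ,
  inj₂ (sym (*-identityˡ A) , sym (*-identityˡ _))
common-power {p} pr (suc n) A | yes (divides-refl A′) = raise (common-power pr n A′)
  where
  raise-A : ∀ j {C} → A′ ≡ p ^ j * C → A′ * p ≡ p ^ suc j * C
  raise-A j {C} refl = trans (*-comm _ p) (sym (*-assoc p (p ^ j) C))
  factor : ∀ a p q → 2 * (a * p) + p * q ≡ p * (2 * a + q)
  factor = solve-∀
  raise-B : ∀ j {D} → 2 * A′ + p ^ n ≡ p ^ j * D → 2 * (A′ * p) + p ^ suc n ≡ p ^ suc j * D
  raise-B j {D} eq = trans (factor A′ p (p ^ n)) (trans (cong (p *_) eq) (sym (*-assoc p (p ^ j) D)))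
  raise : CommonPower p A′ (2 * A′ + p ^ n) → CommonPower p (A′ * p) (2 * (A′ * p) + p ^ suc n)
  raise (j , C , D , cop , copp , inj₁ (eqA , eqB)) =
    suc j , C , D , cop , copp , inj₁ (raise-A j eqA , raise-B j eqB)
  raise (j , C , D , cop , copp , inj₂ (eqA , eqB)) =
    suc j , C , D , cop , copp , inj₂ (raise-A j eqA , raise-B j eqB)

A[2A+11^n]-not-perfect : ∀ n A → A % 8 ≡ 5 → (2 * A + 11 ^ n) % 8 ≡ 5 → ¬ Perfect (A * (2 * A + 11 ^ n))
A[2A+11^n]-not-perfect n A A≡5 B≡5 perf with common-power (from-yes (prime? 11)) n A
... | j , C , D , cop , cop11 , inj₁ (eqA , eqB) =
  ¬perfect-by-coprime-factors j C D cop cop11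
    (subst (λ z → z % 8 ≡ 5) eqA A≡5) (subst (λ z → z % 8 ≡ 5) eqB B≡5)
    (subst Perfect (cong₂ _*_ eqA eqB) perf)
... | j , C , D , cop , cop11 , inj₂ (eqA , eqB) =
  ¬perfect-by-coprime-factors j C D cop cop11
    (subst (λ z → z % 8 ≡ 5) eqB B≡5) (subst (λ z → z % 8 ≡ 5) eqA A≡5)
    (subst Perfect (trans (cong₂ _*_ eqA eqB) (*-comm (11 ^ j * D) (11 ^ j * C))) perf)

-- The differences δ = g (2g − 1) with 4g − 1 a power of 11

-- Besides the congruence modulo `N`, the bound `t ≤ c` is carried along: each step raises `c` by at
-- least `K ≥ 1`. It later makes the differences unbounded.
powers-of-1+KN : ∀ {r} N K .{{_ : NonZero K}} a → r ≡ 1 + K * N →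
  ∀ t → ∃ λ c → t ≤ c × suc a * r ^ t ≡ suc a + N * c
powers-of-1+KN N K a r≡ zero =
  0 , z≤n , trans (*-identityʳ (suc a)) (sym (trans (cong (suc a +_) (*-zeroʳ N)) (+-identityʳ (suc a))))
powers-of-1+KN {r} N K a r≡ (suc t) =
  let c , t≤c , eq = powers-of-1+KN N K a r≡ t in
  c + K + (a * K + N * (c * K)) ,
  m≤n⇒m≤n+o _ (subst (_≤ c + K) (+-comm t 1) (+-mono-≤ t≤c (>-nonZero⁻¹ K))) ,
  (begin
    suc a * (r * r ^ t)                         ≡⟨ swap-factors (suc a) r (r ^ t) ⟩
    r * (suc a * r ^ t)                         ≡⟨ cong₂ _*_ r≡ eq ⟩
    (1 + K * N) * (suc a + N * c)               ≡⟨ expand N K a c ⟩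
    suc a + N * (c + K + (a * K + N * (c * K))) ∎)
  where
  open ≡-Reasoning
  swap-factors : ∀ a b c → a * (b * c) ≡ b * (a * c)
  swap-factors = solve-∀
  expand : ∀ N K a c → (1 + K * N) * (1 + a + N * c) ≡ 1 + a + N * (c + K + (a * K + N * (c * K)))
  expand = solve-∀

-- 11 has multiplicative order 24 modulo 288.
powers-of-11 : ∀ t → ∃ λ c → t ≤ c × 11 ^ suc (24 * t) ≡ 11 + 4 * (72 * c)
powers-of-11 t =
  -- The 10 stands for the extra factor `11 = suc 10`; the remainder of `11 ^ 24` by 288 evaluates
  -- to 1.
  let c , t≤c , eq = powers-of-1+KN 288 (11 ^ 24 / 288) 10 (m≡m%n+[m/n]*n (11 ^ 24) 288) t in
  c , t≤c , trans (cong (11 *_) (sym (^-*-assoc 11 24 t))) (trans eq (cong (11 +_) (*-assoc 4 72 c)))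

2∣n⇒2∤1+n : ∀ {n} → 2 ∣ n → ¬ (2 ∣ suc n)
2∣n⇒2∤1+n {n} 2∣n 2∣1+n =
  contradiction (∣1⇒≡1 (∣m+n∣m⇒∣n (subst (2 ∣_) (+-comm 1 n) 2∣1+n) 2∣n)) λ ()

2∤n⇒2∣1+n : ∀ n → ¬ (2 ∣ n) → 2 ∣ suc n
2∤n⇒2∣1+n zero          2∤0 = contradiction (2 ∣0) 2∤0
2∤n⇒2∣1+n (suc zero)    _   = ∣-refl
2∤n⇒2∣1+n (suc (suc n)) 2∤n = ∣m∣n⇒∣m+n ∣-refl (2∤n⇒2∣1+n n (2∤n ∘ ∣m∣n⇒∣m+n ∣-refl))

∣-multiple : ∀ {d} N w → d ∣ N → d ∣ N * w
∣-multiple N w d∣N = ∣-trans d∣N (m∣m*n w)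

-- This is g (2g - 1) with g = 3 + 72c, so that 4g - 1 = 11 + 4 (72c) matches `powers-of-11`. The
-- modulus 72 fixes g modulo 8 and the product modulo 36.
difference : ℕ → ℕ
difference c = (3 + 72 * c) * (5 + 2 * (72 * c))

difference≡15+36w : ∀ c → ∃ λ w → difference c ≡ 15 + 36 * w
difference≡15+36w c = 2 * (c * (11 + 2 * (72 * c))) ,
  trans (expand 72 c) (cong (15 +_) (*-assoc 36 2 (c * (11 + 2 * (72 * c)))))
  where
  expand : ∀ N u → (3 + N * u) * (5 + 2 * (N * u)) ≡ 15 + N * (u * (11 + 2 * (N * u)))
  expand = solve-∀

-- Here 3 divides the number exactly once, and σ(3) = 4.
21+36w-not-perfect : ∀ w → ¬ Perfect (21 + 36 * w)
21+36w-not-perfect w perf =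
  2∣n⇒2∤1+n {20 + 36 * w} (∣m∣n⇒∣m+n (divides 10 refl) (∣-multiple 36 w (divides 18 refl)))
    (perfect∧4∣σ⇒2∣ perf (subst (4 ∣_) (sym σ≡) (m∣m*n (σ (7 + 12 * w)))))
  where
  factor : 21 + 36 * w ≡ 3 * (7 + 12 * w)
  factor = trans (cong (21 +_) (*-assoc 3 12 w)) (sym (*-distribˡ-+ 3 7 (12 * w)))
  coprime : Coprime 3 (7 + 12 * w)
  coprime {d} (d∣3 , d∣r) =
    ∣1⇒≡1 (∣m+n∣m⇒∣n (subst (d ∣_) (+-comm 1 (6 + 12 * w)) d∣r)
      (∣-trans d∣3 (∣m∣n⇒∣m+n (divides 2 refl) (∣-multiple 12 w (divides 4 refl)))))
  σ≡ : σ (21 + 36 * w) ≡ 4 * σ (7 + 12 * w)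
  σ≡ = trans (cong σ factor) (σ-multiplicative 3 (7 + 12 * w) coprime)

3-mod-4-not-perfect : ∀ {n} → n % 4 ≡ 3 → ¬ Perfect n
3-mod-4-not-perfect {n} n%4≡3 perf@(n≢0 , _) = from-no (2 ∣? 3)
  (subst (2 ∣_) n%4≡3
    (%-presˡ-∣ (perfect∧4∣σ⇒2∣ perf (3-mod-4⇒4∣σ n {{n≢0}} n%4≡3)) (divides 2 refl)))

euclid+difference-not-perfect : ∀ k Q c → suc Q ≡ 2 * 2 ^ suc k → ¬ Perfect (2 ^ suc k * Q + difference c)
-- Here `Q` is 3 and the even perfect number is 6, so the sum is 21 modulo 36.
euclid+difference-not-perfect zero Q c 1+Q≡ perf with refl ← suc-injective 1+Q≡ =
  let w , δ≡ = difference≡15+36w c in 21+36w-not-perfect w (subst Perfect (cong (6 +_) δ≡) perf)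
-- Now 4 divides the even perfect number, so the sum is 15 ≡ 3 modulo 4.
euclid+difference-not-perfect (suc k) Q c _ =
  let w , δ≡ = difference≡15+36w c in
  3-mod-4-not-perfect (trans (%-remove-+ˡ {2 ^ suc (suc k) * Q} (difference c) (∣m⇒∣m*n Q 4∣2^2+k))
    (trans (cong (_% 4) δ≡) (%-remove-+ʳ 15 {36 * w} {4} (∣-multiple 36 w (divides 9 refl)))))
  where
  4∣2^2+k : 4 ∣ 2 ^ suc (suc k)
  4∣2^2+k = subst (4 ∣_) (*-assoc 2 2 (2 ^ k)) (m∣m*n (2 ^ k))

8≤2^k⇒8∣2^k : ∀ k → 8 ≤ 2 ^ k → 8 ∣ 2 ^ k
8≤2^k⇒8∣2^k 0 (s≤s ())
8≤2^k⇒8∣2^k 1 (s≤s (s≤s ()))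
8≤2^k⇒8∣2^k 2 (s≤s (s≤s (s≤s (s≤s ()))))
8≤2^k⇒8∣2^k (suc (suc (suc k))) _ = divides (2 ^ k) (rearrange (2 ^ k))
  where
  rearrange : ∀ p → 2 * (2 * (2 * p)) ≡ p * 8
  rearrange = solve-∀

-- With h = 2g - 1 and A = P - g, the identity P (2P - 1) - g (2g - 1) = A (2A + 4g - 1) puts `y` in
-- the form excluded above.
euclid≢perfect+difference : ∀ k Q c n y → 11 ^ n ≡ 11 + 4 * (72 * suc c) → suc Q ≡ 2 * 2 ^ k →
  Perfect y → 2 ^ k * Q ≢ y + difference (suc c)
euclid≢perfect+difference k Q c n y 11^n≡ 1+Q≡ perf@(y≢0 , _) eq =
  A[2A+11^n]-not-perfect n A A≡5 B≡5 (subst Perfect y≡AB perf)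
  where
  P = 2 ^ k
  v = 72 * suc c
  g = 3 + v
  h = 5 + 2 * v
  1+h≡2g : ∀ v → suc (5 + 2 * v) ≡ 2 * (3 + v)
  1+h≡2g = solve-∀
  -- If `P ≤ g`, then `Q ≤ h` and `P * Q ≤ g * h`, too small because `y` is positive.
  g≤P : g ≤ P
  g≤P with ≤-total g P
  ... | inj₁ g≤P = g≤P
  ... | inj₂ P≤g = contradiction
    (subst (_≤ g * h) eq (*-mono-≤ P≤g Q≤h))
    (<⇒≱ (m<n+m (g * h) (>-nonZero⁻¹ y {{y≢0}})))
    where
    Q≤h : Q ≤ h
    Q≤h = s≤s⁻¹ (subst₂ _≤_ (sym 1+Q≡) (sym (1+h≡2g v)) (*-monoʳ-≤ 2 P≤g))
  A = proj₁ (m≤n⇒∃[o]m+o≡n g≤P)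
  P≡g+A : P ≡ g + A
  P≡g+A = sym (proj₂ (m≤n⇒∃[o]m+o≡n g≤P))
  Q≡h+2A : Q ≡ h + 2 * A
  Q≡h+2A = suc-injective (begin
    suc Q           ≡⟨ 1+Q≡ ⟩
    2 * P           ≡⟨ cong (2 *_) P≡g+A ⟩
    2 * (g + A)     ≡⟨ *-distribˡ-+ 2 g A ⟩
    2 * g + 2 * A   ≡⟨ cong (_+ 2 * A) (1+h≡2g v) ⟨
    suc h + 2 * A   ∎)
    where open ≡-Reasoning
  expand : ∀ v A → (3 + v + A) * (5 + 2 * v + 2 * A) ≡
                   A * (2 * A + (11 + 4 * v)) + (3 + v) * (5 + 2 * v)
  expand = solve-∀
  y≡AB : y ≡ A * (2 * A + 11 ^ n)
  y≡AB = +-cancelʳ-≡ (g * h) y (A * (2 * A + 11 ^ n)) (begin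
    y + g * h                            ≡⟨ eq ⟨
    P * Q                                ≡⟨ cong₂ _*_ P≡g+A Q≡h+2A ⟩
    (g + A) * (h + 2 * A)                ≡⟨ expand v A ⟩
    A * (2 * A + (11 + 4 * v)) + g * h   ≡⟨ cong (λ z → A * (2 * A + z) + g * h) 11^n≡ ⟨
    A * (2 * A + 11 ^ n) + g * h         ∎)
    where open ≡-Reasoning
  -- Taking `suc c` makes `g` at least 75, so the power of two `P ≥ g` is a multiple of 8 and A ≡ -3
  -- ≡ 5 modulo 8.
  8≤g : 8 ≤ g
  8≤g = +-monoʳ-≤ 3 (≤-trans (m≤m+n 5 67) (m≤m*n 72 (suc c)))
  8∣v : 8 ∣ v
  8∣v = ∣-multiple 72 (suc c) (divides 9 refl)
  regroup : ∀ v A → 3 + v + A ≡ v + (3 + A)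
  regroup = solve-∀
  8∣3+A : 8 ∣ 3 + A
  8∣3+A = ∣m+n∣m⇒∣n (subst (8 ∣_) (trans P≡g+A (regroup v A)) (8≤2^k⇒8∣2^k k (≤-trans 8≤g g≤P))) 8∣v
  A≡5 : A % 8 ≡ 5
  A≡5 = residues (λ r → (3 + r) % 8 ≡ 0 → r ≡ 5)
    (from-yes (all? λ (i : Fin 8) → ((3 + toℕ i) % 8 ≟ 0) →-dec (toℕ i ≟ 5))) (m%n<n A 8)
    (trans (sym (%-distribˡ-+ 3 A 8)) (n∣m⇒m%n≡0 (3 + A) 8 8∣3+A))
  B≡5 : (2 * A + 11 ^ n) % 8 ≡ 5
  B≡5 = begin
    (2 * A + 11 ^ n) % 8          ≡⟨ cong (λ z → (2 * A + z) % 8) 11^n≡ ⟩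
    (2 * A + (11 + 4 * v)) % 8    ≡⟨ cong (_% 8) (+-assoc (2 * A) 11 (4 * v)) ⟨
    (2 * A + 11 + 4 * v) % 8      ≡⟨ %-remove-+ʳ (2 * A + 11) {4 * v} {8} (∣n⇒∣m*n 4 8∣v) ⟩
    (2 * A + 11) % 8              ≡⟨ %-distribˡ-+ (2 * A) 11 8 ⟩
    (2 * A % 8 + 3) % 8           ≡⟨ cong (λ r → (r + 3) % 8) (%-distribˡ-* 2 A 8) ⟩
    (2 * (A % 8) % 8 + 3) % 8     ≡⟨ cong (λ r → (2 * r % 8 + 3) % 8) A≡5 ⟩
    5                             ∎
    where open ≡-Reasoning

-- Combination of the two parities of y

difference-of-perfects≢ : ∀ n c → 11 ^ n ≡ 11 + 4 * (72 * suc c) →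
  ¬ (∃ λ x → ∃ λ y → Perfect x × Perfect y × x ≡ y + difference (suc c))
difference-of-perfects≢ n c 11^n≡ (x , y , px , py , x≡) with 2 ∣? y
... | yes 2∣y = let k , Q , y≡ , 1+Q≡ = even-perfect⇒euclid py 2∣y in
  euclid+difference-not-perfect k Q (suc c) 1+Q≡
    (subst Perfect (trans x≡ (cong (_+ difference (suc c)) y≡)) px)
... | no 2∤y = let k , Q , x≡′ , 1+Q≡ = even-perfect⇒euclid px 2∣x in
  euclid≢perfect+difference (suc k) Q c n y 11^n≡ 1+Q≡ py (trans (sym x≡′) x≡)
  where
  2∣x : 2 ∣ x
  2∣x = let w , δ≡ = difference≡15+36w (suc c) in
    subst (2 ∣_) (sym (trans x≡ (trans (cong (y +_) δ≡) (+-suc y (14 + 36 * w)))))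
      (∣m∣n⇒∣m+n (2∤n⇒2∣1+n y 2∤y) (∣m∣n⇒∣m+n (divides 7 refl) (∣-multiple 36 w (divides 18 refl))))

large-difference : ∀ n m c → m < c → 11 ^ n ≡ 11 + 4 * (72 * c) →
  ∃ λ δ → m < δ × Triangular δ × δ % 12 ≡ 3 × ¬ (∃ λ x → ∃ λ y → Perfect x × Perfect y × x ≡ y + δ)
-- The bound `m < c` excludes `c = 0`. The triangular witness is k = 2g - 1, that is, b = 2g.
large-difference n m (suc c) m<c 11^n≡ =
  difference (suc c) , m<δ , (5 + 2 * v , triangular v) , δ%12≡3 , difference-of-perfects≢ n c 11^n≡
  where
  v = 72 * suc c
  triangular : ∀ v → 2 * ((3 + v) * (5 + 2 * v)) ≡ suc (5 + 2 * v) * (5 + 2 * v)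
  triangular = solve-∀
  m<δ : m < difference (suc c)
  m<δ = ≤-trans m<c (≤-trans (m≤n*m (suc c) 72) (≤-trans (m≤n+m v 3) (m≤m*n (3 + v) (5 + 2 * v))))
  δ%12≡3 : difference (suc c) % 12 ≡ 3
  δ%12≡3 = let w , δ≡ = difference≡15+36w (suc c) in
    trans (cong (_% 12) δ≡) (%-remove-+ʳ 15 {36 * w} {12} (∣-multiple 36 w (divides 3 refl)))

theorem3p3 : ∀ (m : ℕ) → ∃ λ δ → m < δ × Triangular δ × δ % 12 ≡ 3
    × ¬ (∃ λ x → ∃ λ y → Perfect x × Perfect y × x ≡ y + δ)
theorem3p3 m =
  -- Starting from `suc m` turns the bound `t ≤ c` into `m < c`.
  let c , m<c , 11^n≡ = powers-of-11 (suc m) in large-difference (suc (24 * suc m)) m c m<c 11^n≡
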